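{- Let $F$ be a uniformly recurrent set. Then every $F$-thin bifix code $X\subset F$ is finite, and every finite bifix code $X\subset F$ is contained in a finite $F$-maximal bifix code $Y\subset F$.
   Context: $A$ is a finite alphabet. $F\subset A^*$ is uniformly recurrent if it is nonempty, closed under factors, every $w\in F$ has some letter $a$ with $wa\in F$, and for every $u\in F$ there is $n\ge1$ such that $u$ is a factor of every word of $F\cap A^n$. A bifix code is a set of nonempty words none of which is a proper prefix or proper suffix of another. $X\subset F$ is $F$-thin if some word of $F$ is not a factor of any word of $X$; it is $F$-maximal bifix if not properly contained in any bifix code contained in $F$. -}

module Defs where

open import Level using (Level; suc)
open import Data.Fin.Base using (Fin)
open import Data.List.Base using (List; []; length; _∷ʳ_)
open import Data.List.Membership.Propositional renaming (_∈_ to _∈ˡ_)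
open import Data.List.Relation.Binary.Infix.Heterogeneous using (Infix)
open import Data.List.Relation.Binary.Prefix.Heterogeneous using (Prefix)
open import Data.List.Relation.Binary.Suffix.Heterogeneous using (Suffix)
open import Data.Nat.Base using (_≥_)
open import Data.Product.Base using (∃; ∃-syntax; _×_)
open import Function.Bundles using (_⇔_; _↔_)
open import Relation.Binary.PropositionalEquality using (_≡_; _≢_)
open import Relation.Nullary.Negation using (¬_)
open import Relation.Unary using (Pred; _∈_; _⊆_; _⊄_; Satisfiable)

private
  variable
    ℓ : Level
    A : Set ℓ

FiniteType : Set ℓ → Set ℓ
FiniteType A = ∃[ k ] (A ↔ Fin k)

-- A language is a subset of A*.  Alphabet and membership share one universe
-- level, so that factor, thinness, etc. stay at that level.
Language : Set ℓ → Set (suc ℓ)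
Language {ℓ} A = Pred (List A) ℓ

_isFactorOf_ : List A → List A → Set _
u isFactorOf w = Infix _≡_ u w

_isProperPrefixOf_ : List A → List A → Set _
u isProperPrefixOf w = Prefix _≡_ u w × u ≢ w

_isProperSuffixOf_ : List A → List A → Set _
u isProperSuffixOf w = Suffix _≡_ u w × u ≢ w

-- The listing is exact (it may contain repetitions).
Finite : Language A → Set _
Finite {A = A} X = ∃[ ws ] ((w : List A) → w ∈ X ⇔ w ∈ˡ ws)

record UniformlyRecurrent {A : Set ℓ} (F : Language A) : Set ℓ where
  field
    nonempty        : Satisfiable F
    factorClosed    : ∀ {u w} → w ∈ F → u isFactorOf w → u ∈ F
    rightExtendable : ∀ {w} → w ∈ F → ∃[ a ] w ∷ʳ a ∈ F
    recurrence      : ∀ {u} → u ∈ F →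
                      ∃[ n ] n ≥ 1 × (∀ {w} → w ∈ F → length w ≡ n → u isFactorOf w)

record BifixCode {A : Set ℓ} (X : Language A) : Set ℓ where
  field
    nonemptyWords : ∀ {x} → x ∈ X → x ≢ []
    prefixFree    : ∀ {x y} → x ∈ X → y ∈ X → ¬ (x isProperPrefixOf y)
    suffixFree    : ∀ {x y} → x ∈ X → y ∈ X → ¬ (x isProperSuffixOf y)

Thin : Language A → Language A → Set _
Thin F X = ∃[ w ] w ∈ F × (∀ {x} → x ∈ X → ¬ (w isFactorOf x))

record MaximalBifixCode {A : Set ℓ} (F X : Language A) : Set (suc ℓ) where
  field
    bifixCode : BifixCode X
    included  : X ⊆ F
    maximal   : (Z : Language A) → BifixCode Z → Z ⊆ F → X ⊄ Z

{-# OPTIONS --safe #-}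

-- A word of F that is no factor of X occurs in all sufficiently long words
-- of F, so the words of an F-thin code have bounded length.
--
-- For the completion of a finite bifix code X, let parses w be the number of
-- suffixes of w (the empty one included) having no prefix in X.  Since X is
-- bifix, this number is left-right symmetric: adding a letter on the left
-- (right) leaves it unchanged if the new word has a prefix (suffix) in X, and
-- increases it by one otherwise.  Fix k larger than parses x for all x ∈ X.
-- * If parses ≤ k on F, then X itself is F-maximal: were some z ∈ F such that
--   no extension of z in F has a prefix in X, then prepending z repeatedly
--   would produce words of F with arbitrarily many parses.
-- * Otherwise, by uniform recurrence, parses exceeds k on all long words of F,
--   and X is completed by the words awb ∈ F such that
--   parses w = k and parses aw = parses wb = k + 1.
module Submission where

open import Defs
open import Axiom.ExcludedMiddle using (ExcludedMiddle)
open import Data.List.Base using (List; []; _∷_; [_]; _++_; _∷ʳ_; length; map; take; drop; filter; allFin; cartesianProductWith)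
open import Data.List.Extrema.Nat using (max; xs≤max)
open import Data.List.Membership.Propositional using () renaming (_∈_ to _∈ˡ_)
open import Data.List.Membership.Propositional.Properties using (∈-map⁺; ∈-++⁺ʳ; ∈-filter⁺; ∈-filter⁻; ∈-allFin; ∈-cartesianProductWith⁺)
open import Data.List.Properties using (∷ʳ-injectiveˡ; ++-assoc; ++-identityʳ; length-++; length-take; take++drop≡id)
open import Data.List.Relation.Binary.Infix.Heterogeneous using (here; there; _++ⁱ_; _ⁱ++_)
open import Data.List.Relation.Binary.Infix.Heterogeneous.Properties using (fromSuffix)
open import Data.List.Relation.Binary.Pointwise using ([]; _∷_; Pointwise-≡⇒≡; ≡⇒Pointwise-≡)
open import Data.List.Relation.Binary.Prefix.Heterogeneous as Prefix using (Prefix; []; _∷_; _++ᵖ_)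
open import Data.List.Relation.Binary.Suffix.Heterogeneous using (Suffix; here; there)
open import Data.List.Relation.Binary.Suffix.Heterogeneous.Properties using () renaming (length-mono to Suffix-length-mono)
import Data.List.Relation.Binary.Prefix.Heterogeneous.Properties as Prefixₚ
open import Data.List.Relation.Unary.Any using (here)
import Data.List.Relation.Unary.All as All
open import Data.Nat.Base using (ℕ; zero; suc; _+_; _≤_; _<_; z≤n; s≤s)
open import Data.Nat.Properties using (≤-refl; ≤-reflexive; ≤-trans; ≤-antisym; ≤-pred; <⇒≤; <⇒≱; ≰⇒>; ≮⇒≥; n≤1+n; m≤n+m; m≤m+n; 1+n≢n; +-suc; +-comm; m≤n⇒m⊓n≡m; _≤?_)
open import Data.Product.Base using (Σ-syntax; ∃-syntax; _×_; _,_; proj₁; proj₂)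
open import Data.Sum.Base using (_⊎_; inj₁; inj₂; [_,_]′)
open import Function.Base using (_∘_)
open import Function.Bundles using (Inverse; Equivalence; mk⇔)
open import Level using (Level)
open import Relation.Binary.PropositionalEquality using (_≡_; _≢_; refl; sym; trans; cong; cong₂; subst)
open import Relation.Nullary using (¬_; Dec; yes; no; contradiction)
open import Relation.Nullary.Decidable using (decidable-stable)
open import Relation.Unary using (_⊆_; _∈_)

private
  variable
    ℓ : Level
    A : Set ℓ

-- Prefixes, suffixes and factors

Prefix-refl : ∀ {u : List A} → Prefix _≡_ u u
Prefix-refl = Prefixₚ.fromPointwise (≡⇒Pointwise-≡ refl)

Prefix-∷ʳ⁻ : ∀ {u : List A} v {b} → Prefix _≡_ u (v ∷ʳ b) → Prefix _≡_ u v ⊎ u ≡ v ∷ʳ b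
Prefix-∷ʳ⁻ []      []          = inj₁ []
Prefix-∷ʳ⁻ []      (refl ∷ []) = inj₂ refl
Prefix-∷ʳ⁻ (c ∷ v) []          = inj₁ []
Prefix-∷ʳ⁻ (c ∷ v) (refl ∷ p) with Prefix-∷ʳ⁻ v p
... | inj₁ q    = inj₁ (refl ∷ q)
... | inj₂ refl = inj₂ refl

Prefix-total : ∀ {u v w : List A} → Prefix _≡_ u w → Prefix _≡_ v w → Prefix _≡_ u v ⊎ Prefix _≡_ v u
Prefix-total []         _          = inj₁ []
Prefix-total (_ ∷ _)    []         = inj₂ []
Prefix-total (refl ∷ p) (refl ∷ q) with Prefix-total p q
... | inj₁ r = inj₁ (refl ∷ r)
... | inj₂ r = inj₂ (refl ∷ r)

Suffix-∷ʳ⁻ : ∀ (u v : List A) {b c} → Suffix _≡_ (u ∷ʳ b) (v ∷ʳ c) → Suffix _≡_ u v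
Suffix-∷ʳ⁻ u       (d ∷ v) (there s) = there (Suffix-∷ʳ⁻ u v s)
Suffix-∷ʳ⁻ u       (d ∷ v) (here p)  = here (≡⇒Pointwise-≡ (∷ʳ-injectiveˡ u (d ∷ v) (Pointwise-≡⇒≡ p)))
Suffix-∷ʳ⁻ []      []      _         = here []
Suffix-∷ʳ⁻ (_ ∷ [])    [] (here (_ ∷ ()))
Suffix-∷ʳ⁻ (_ ∷ _ ∷ _) [] (here (_ ∷ ()))
Suffix-∷ʳ⁻ (_ ∷ _)     [] (there (here ()))

length<⇒≢ : ∀ {u v : List A} → length u < length v → u ≢ v
length<⇒≢ u<v refl = <⇒≱ u<v ≤-refl

-- Finite languages

module _ {A : Set ℓ} (A-finite : FiniteType A) where

  private
    letters : List A
    letters = map (Inverse.from (proj₂ A-finite)) (allFin _)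

    ∈-letters : ∀ a → a ∈ˡ letters
    ∈-letters a = subst (_∈ˡ letters) (Inverse.strictlyInverseʳ (proj₂ A-finite) a)
      (∈-map⁺ _ (∈-allFin _))

  wordsUpTo : ℕ → List (List A)
  wordsUpTo zero    = [ [] ]
  wordsUpTo (suc n) = [] ∷ cartesianProductWith _∷_ letters (wordsUpTo n)

  ∈-wordsUpTo : ∀ n {w} → length w ≤ n → w ∈ˡ wordsUpTo n
  ∈-wordsUpTo zero    {[]}    _       = here refl
  ∈-wordsUpTo (suc n) {[]}    _       = here refl
  ∈-wordsUpTo (suc n) {a ∷ w} (s≤s l) =
    ∈-++⁺ʳ [ [] ] (∈-cartesianProductWith⁺ _∷_ (∈-letters a) (∈-wordsUpTo n l))

  bounded⇒finite : ExcludedMiddle ℓ → (X : Language A) → ∀ n →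
                   (∀ {w} → w ∈ X → length w ≤ n) → Finite X
  bounded⇒finite em X n bound = filter X? (wordsUpTo n) , λ w → mk⇔
    (λ w∈X → ∈-filter⁺ X? (∈-wordsUpTo n (bound w∈X)) w∈X)
    (proj₂ ∘ ∈-filter⁻ X? {xs = wordsUpTo n})
    where
    X? : ∀ w → Dec (w ∈ X)
    X? w = em

-- The function `f` is arbitrary because both the lengths and the parse counts of a finite code have
-- to be bounded.
finite⇒bounded : ∀ {X : Language A} (f : List A → ℕ) → Finite X →
                 ∃[ m ] (∀ {x} → x ∈ X → f x ≤ m)
finite⇒bounded f (ws , X⇔ws) = max 0 (map f ws) , λ {x} x∈X →
  All.lookup (xs≤max 0 (map f ws)) (∈-map⁺ f (Equivalence.to (X⇔ws x) x∈X))

-- Uniformly recurrent sets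

module _ {A : Set ℓ} {F : Language A} (F-ur : UniformlyRecurrent F) where

  open UniformlyRecurrent F-ur

  -- The prefix of length `n` of a longer word again lies in `F`, and it already contains `u`.
  recurrence-≤ : ∀ {u} → u ∈ F →
                 ∃[ n ] (∀ {w} → w ∈ F → n ≤ length w → u isFactorOf w)
  recurrence-≤ {u} u∈F with n , _ , occurs ← recurrence u∈F = n , λ {w} w∈F n≤w →
    let w≡ = take++drop≡id n w in
    subst (u isFactorOf_) w≡
      (occurs (factorClosed w∈F (subst (take n w isFactorOf_) w≡ (here (Prefix-refl ++ᵖ drop n w))))
              (trans (length-take n w) (m≤n⇒m⊓n≡m n≤w))
       ⁱ++ drop n w)

  extendable : ∀ n {z} → z ∈ F → ∃[ s ] length s ≡ n × z ++ s ∈ F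
  extendable zero    {z} z∈F = [] , refl , subst F (sym (++-identityʳ z)) z∈F
  extendable (suc n) {z} z∈F
    with a , za∈F ← rightExtendable z∈F
    with s , refl , zas∈F ← extendable n za∈F =
    a ∷ s , refl , subst F (++-assoc z [ a ] s) zas∈F

  -- Enough right extension makes the appended part long, and as a factor it is itself a word of
  -- `F`. Recurrence therefore places `u` inside `s`, without overlapping `z`.
  follows : ∀ {u z} → u ∈ F → z ∈ F → ∃[ s ] u isFactorOf s × z ++ s ∈ F
  follows {z = z} u∈F z∈F
    with n , occurs ← recurrence-≤ u∈F
    with s , refl , zs∈F ← extendable n z∈F =
    s , occurs (factorClosed zs∈F (z ++ⁱ here Prefix-refl)) ≤-refl , zs∈F

-- Prefixes of a common word in a bifix code coincide, so a code meeting every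
-- cone of F cannot be enlarged.
rightDense⇒maximal : ExcludedMiddle ℓ → {A : Set ℓ} {F Y : Language A} →
  BifixCode Y → Y ⊆ F →
  (∀ {z} → z ∈ F → z ≢ [] → ∃[ s ] ∃[ y ] y ∈ Y × Prefix _≡_ y (z ++ s)) →
  MaximalBifixCode F Y
rightDense⇒maximal em {F = F} {Y} Y-bifix Y⊆F dense = record
  { bifixCode = Y-bifix
  ; included  = Y⊆F
  ; maximal   = λ Z Z-bifix Z⊆F (Y⊆Z , Z⊈Y) → Z⊈Y λ {z} z∈Z →
      let open BifixCode Z-bifix
          s , y , y∈Y , y≤zs = dense (Z⊆F z∈Z) (nonemptyWords z∈Z)
          prefix⇒≡ : ∀ {u v} → u ∈ Z → v ∈ Z → Prefix _≡_ u v → u ≡ v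
          prefix⇒≡ u∈Z v∈Z p = decidable-stable em λ u≢v → prefixFree u∈Z v∈Z (p , u≢v)
          y≡z = [ prefix⇒≡ (Y⊆Z y∈Y) z∈Z , sym ∘ prefix⇒≡ z∈Z (Y⊆Z y∈Y) ]′
                (Prefix-total y≤zs (Prefix-refl ++ᵖ s))
      in subst Y y≡z y∈Y
  }

-- Counting parses

module Parses (em : ExcludedMiddle ℓ) {A : Set ℓ} {X : Language A} (X-bifix : BifixCode X) where

  open BifixCode X-bifix

  HasPrefix HasSuffix : List A → Set ℓ
  HasPrefix w = ∃[ x ] x ∈ X × Prefix _≡_ x w
  HasSuffix w = ∃[ x ] x ∈ X × Suffix _≡_ x w

  fromDec : ∀ {P : Set ℓ} → Dec P → ℕ
  fromDec (yes _) = 0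
  fromDec (no _)  = 1

  unparsed : List A → ℕ
  unparsed w = fromDec (em {HasPrefix w})

  -- The value 1 at `[]` counts the empty suffix, which has no prefix in `X` because words of `X`
  -- are nonempty. The recursion makes the effect of prepending immediate; the effect of appending
  -- is the content of `parses-∷ʳ`.
  parses : List A → ℕ
  parses []      = 1
  parses (a ∷ w) = unparsed (a ∷ w) + parses w

  unparsed-yes : ∀ {w} → HasPrefix w → unparsed w ≡ 0
  unparsed-yes {w} p with em {HasPrefix w}
  ... | yes _ = refl
  ... | no ¬p = contradiction p ¬p

  unparsed-no : ∀ {w} → ¬ HasPrefix w → unparsed w ≡ 1
  unparsed-no {w} ¬p with em {HasPrefix w}
  ... | yes p = contradiction p ¬p
  ... | no _  = refl

  parses-∷-no : ∀ {a w} → ¬ HasPrefix (a ∷ w) → parses (a ∷ w) ≡ suc (parses w)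
  parses-∷-no ¬p = cong (_+ _) (unparsed-no ¬p)

  parses-∷-yes : ∀ {a w} → HasPrefix (a ∷ w) → parses (a ∷ w) ≡ parses w
  parses-∷-yes p = cong (_+ _) (unparsed-yes p)

  -- The only prefix of `w ∷ʳ b` that is not already a prefix of `w` is the whole word.
  unparsed-∷ʳ : ∀ {w b} → ¬ (w ∷ʳ b ∈ X) → unparsed (w ∷ʳ b) ≡ unparsed w
  unparsed-∷ʳ {w} {b} wb∉X with em {HasPrefix w}
  ... | yes (x , x∈X , p) = unparsed-yes (x , x∈X , p ++ᵖ [ b ])
  ... | no ¬p = unparsed-no λ (x , x∈X , p) → shorter x∈X (Prefix-∷ʳ⁻ w p)
    where
    shorter : ∀ {x} → x ∈ X → ¬ (Prefix _≡_ x w ⊎ x ≡ w ∷ʳ b)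
    shorter x∈X (inj₁ q)    = ¬p (_ , x∈X , q)
    shorter x∈X (inj₂ refl) = wb∉X x∈X

  HasSuffix-∷⁻ : ∀ {a w} → ¬ (a ∷ w ∈ X) → HasSuffix (a ∷ w) → HasSuffix w
  HasSuffix-∷⁻ aw∉X (x , x∈X , here p)  = contradiction (subst X (Pointwise-≡⇒≡ p) x∈X) aw∉X
  HasSuffix-∷⁻ aw∉X (x , x∈X , there s) = x , x∈X , s

  -- Prefixes in X distinguish aw from awb only if awb ∈ X; then wb has no
  -- suffix in X, so the parse lost by prepending a is the one gained by
  -- appending b.
  parses-∷ʳ : ∀ w b → HasSuffix (w ∷ʳ b) × parses (w ∷ʳ b) ≡ parses w
                    ⊎ ¬ HasSuffix (w ∷ʳ b) × parses (w ∷ʳ b) ≡ suc (parses w)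
  parses-∷ʳ [] b with em {[ b ] ∈ X}
  ... | yes b∈X = inj₁ ((_ , b∈X , here (refl ∷ [])) , parses-∷-yes (_ , b∈X , Prefix-refl))
  ... | no  b∉X = inj₂ (noEmptySuffix ∘ HasSuffix-∷⁻ b∉X ,
    cong (_+ 1) (trans (unparsed-∷ʳ {[]} b∉X) (unparsed-no noEmptyPrefix)))
    where
    noEmptySuffix : ¬ HasSuffix []
    noEmptySuffix (_ , x∈X , here []) = nonemptyWords x∈X refl
    noEmptyPrefix : ¬ HasPrefix []
    noEmptyPrefix (_ , x∈X , []) = nonemptyWords x∈X refl
  parses-∷ʳ (a ∷ w) b with em {a ∷ w ∷ʳ b ∈ X} | parses-∷ʳ w b
  ... | no awb∉X | inj₁ ((x , x∈X , s) , eq) =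
    inj₁ ((x , x∈X , there s) , cong₂ _+_ (unparsed-∷ʳ {a ∷ w} awb∉X) eq)
  ... | no awb∉X | inj₂ (¬s , eq) =
    inj₂ (¬s ∘ HasSuffix-∷⁻ awb∉X , trans (cong₂ _+_ (unparsed-∷ʳ {a ∷ w} awb∉X) eq) (+-suc _ _))
  ... | yes awb∈X | inj₁ ((x , x∈X , s) , _) =
    contradiction (there s , length<⇒≢ (s≤s (Suffix-length-mono s))) (suffixFree x∈X awb∈X)
  ... | yes awb∈X | inj₂ (_ , eq) =
    inj₁ ((_ , awb∈X , here (≡⇒Pointwise-≡ refl)) ,
      trans (parses-∷-yes (_ , awb∈X , Prefix-refl)) (trans eq (sym (parses-∷-no noPrefix))))
    where
    noPrefix : ¬ HasPrefix (a ∷ w)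
    noPrefix (x , x∈X , p) = prefixFree x∈X awb∈X (p ++ᵖ [ b ] ,
      length<⇒≢ (≤-trans (s≤s (Prefixₚ.length-mono p))
        (≤-reflexive (cong suc (trans (+-comm 1 _) (sym (length-++ w)))))))

  parses-∷-≤ : ∀ a w → parses w ≤ parses (a ∷ w)
  parses-∷-≤ a w = m≤n+m _ _

  parses-∷ʳ-≤ : ∀ w b → parses w ≤ parses (w ∷ʳ b)
  parses-∷ʳ-≤ w b with parses-∷ʳ w b
  ... | inj₁ (_ , eq) = ≤-reflexive (sym eq)
  ... | inj₂ (_ , eq) = ≤-trans (n≤1+n _) (≤-reflexive (sym eq))

  parses-∷ʳ-≤-suc : ∀ w b → parses (w ∷ʳ b) ≤ suc (parses w)
  parses-∷ʳ-≤-suc w b with parses-∷ʳ w b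
  ... | inj₁ (_ , eq) = ≤-trans (≤-reflexive eq) (n≤1+n _)
  ... | inj₂ (_ , eq) = ≤-reflexive eq

  parses-++-≤ : ∀ u s → parses u ≤ parses (u ++ s)
  parses-++-≤ u []      = ≤-reflexive (cong parses (sym (++-identityʳ u)))
  parses-++-≤ u (b ∷ s) = ≤-trans (parses-∷ʳ-≤ u b)
    (≤-trans (parses-++-≤ (u ∷ʳ b) s) (≤-reflexive (cong parses (++-assoc u [ b ] s))))

  -- A word arises from any of its factors by appending and then prepending letters, and neither
  -- operation lowers the count.
  parses-mono : ∀ {u w} → u isFactorOf w → parses u ≤ parses w
  parses-mono {u} (here p)
    with q Prefix.++ s ← Prefix.toView p
    with refl ← Pointwise-≡⇒≡ q = parses-++-≤ u s
  parses-mono (there i) = ≤-trans (parses-mono i) (parses-∷-≤ _ _)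

  -- A discrete intermediate value argument: each appended letter raises the count by at most one,
  -- so it equals `k` just before it first exceeds `k`. The word `u` is the part already read.
  parses-crossing : ∀ {k} u v → parses u ≤ k → k < parses (u ++ v) →
    ∃[ w ] ∃[ b ] ∃[ s ] u ++ v ≡ w ∷ʳ b ++ s × parses w ≡ k × parses (w ∷ʳ b) ≡ suc k
  parses-crossing u [] u≤k k<u =
    contradiction u≤k (<⇒≱ (subst (λ t → _ < parses t) (++-identityʳ u) k<u))
  parses-crossing {k} u (b ∷ v) u≤k k<uv with parses (u ∷ʳ b) ≤? k
  ... | no ub≰k = u , b , v , sym (++-assoc u [ b ] v) , u≡k ,
        ≤-antisym (≤-trans (parses-∷ʳ-≤-suc u b) (s≤s u≤k)) k<ub
    where
    k<ub : k < parses (u ∷ʳ b)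
    k<ub = ≰⇒> ub≰k
    u≡k : parses u ≡ k
    u≡k = ≤-antisym u≤k (≤-pred (≤-trans k<ub (parses-∷ʳ-≤-suc u b)))
  ... | yes ub≤k
    with w , b′ , s , eq , w≡k , wb≡k ← parses-crossing (u ∷ʳ b) v ub≤k
           (subst (λ t → k < parses t) (sym (++-assoc u [ b ] v)) k<uv) =
    w , b′ , s , trans (sym (++-assoc u [ b ] v)) eq , w≡k , wb≡k

-- Completing a finite bifix code

module Completion (em : ExcludedMiddle ℓ) {A : Set ℓ} {F : Language A} (F-ur : UniformlyRecurrent F)
                  {X : Language A} (X⊆F : X ⊆ F) (X-bifix : BifixCode X) where

  open UniformlyRecurrent F-ur
  open BifixCode X-bifix
  open Parses em X-bifix

  unbounded : ∀ {a t} → a ∷ t ∈ F → ¬ (∃[ s ] HasPrefix (a ∷ t ++ s)) →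
              ∀ j → ∃[ u ] u ∈ F × j ≤ parses u
  unbounded z∈F ¬dense zero = _ , z∈F , z≤n
  unbounded {a} {t} z∈F ¬dense (suc j)
    with u , u∈F , j≤u ← unbounded z∈F ¬dense j
    with s , u≤s , zs∈F ← follows F-ur u∈F z∈F =
    -- `t ++ s` contains `u`, and prepending `a` adds one parse because the whole word has no prefix
    -- in `X`.
    _ , zs∈F , ≤-trans (s≤s (≤-trans j≤u (parses-mono (t ++ⁱ u≤s))))
      (≤-reflexive (sym (parses-∷-no λ p → ¬dense (s , p))))

  bounded⇒maximal : ∀ k → (∀ {u} → u ∈ F → parses u ≤ k) → MaximalBifixCode F X
  bounded⇒maximal k bound = rightDense⇒maximal em X-bifix X⊆F dense
    where
    dense : ∀ {z} → z ∈ F → z ≢ [] → ∃[ s ] HasPrefix (z ++ s)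
    dense {[]}    _   z≢[] = contradiction refl z≢[]
    dense {a ∷ t} z∈F _    = decidable-stable em λ ¬dense →
      let u , u∈F , k<u = unbounded z∈F ¬dense (suc k) in <⇒≱ k<u (bound u∈F)

  -- Given `parses w ≡ k`, the last two equations say that `a ∷ w` has no prefix in `X` and that
  -- `w ∷ʳ b` has no suffix in `X`.
  data Added (k : ℕ) : Language A where
    added : ∀ {a w b} → a ∷ w ∷ʳ b ∈ F → parses w ≡ k →
            parses (a ∷ w) ≡ suc k → parses (w ∷ʳ b) ≡ suc k → a ∷ w ∷ʳ b ∈ Added k

  Completed : ℕ → Language A
  Completed k y = y ∈ X ⊎ y ∈ Added k

  Completed⊆F : ∀ {k} → Completed k ⊆ F
  Completed⊆F (inj₁ x∈X)             = X⊆F x∈X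
  Completed⊆F (inj₂ (added y∈F _ _ _)) = y∈F

  module _ {k : ℕ} (X<k : ∀ {x} → x ∈ X → parses x < k) where

    -- An added word contains some `a ∷ w` with `suc k` parses, more than any word of `X` has.
    Added-noFactor : ∀ {x y} → x ∈ X → y ∈ Added k → ¬ y isFactorOf x
    Added-noFactor x∈X (added {a} {w} {b} _ _ aw≡k _) i = <⇒≱ (X<k x∈X)
      (≤-trans (<⇒≤ (≤-reflexive (sym aw≡k))) (≤-trans (parses-∷ʳ-≤ (a ∷ w) b) (parses-mono i)))

    Completed-bifix : BifixCode (Completed k)
    Completed-bifix = record
      { nonemptyWords = λ { (inj₁ x∈X) → nonemptyWords x∈X ; (inj₂ (added _ _ _ _)) () }
      ; prefixFree = pf
      ; suffixFree = sf
      }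
      where
      pf : ∀ {x y} → x ∈ Completed k → y ∈ Completed k → ¬ (x isProperPrefixOf y)
      pf (inj₁ x∈X) (inj₁ y∈X) = prefixFree x∈X y∈X
      pf (inj₂ x∈D) (inj₁ y∈X) (p , _) = Added-noFactor y∈X x∈D (here p)
      pf (inj₁ x∈X) (inj₂ (added {a} {w} _ w≡k aw≡k _)) (p , x≢y) with Prefix-∷ʳ⁻ (a ∷ w) p
      ... | inj₂ x≡y = x≢y x≡y
      ... | inj₁ q   = 1+n≢n (trans (sym aw≡k) (trans (parses-∷-yes (_ , x∈X , q)) w≡k))
      -- For a proper prefix `avc` of `awb`, the word `vc` would be a prefix of `w`, yet it has one
      -- parse more than `w`.
      pf (inj₂ (added _ _ _ vc≡k)) (inj₂ (added {a} {w} _ w≡k _ _)) (p , x≢y) with Prefix-∷ʳ⁻ (a ∷ w) p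
      ... | inj₂ x≡y     = x≢y x≡y
      ... | inj₁ (_ ∷ q) = <⇒≱ (≤-reflexive (trans (cong suc w≡k) (sym vc≡k))) (parses-mono (here q))

      sf : ∀ {x y} → x ∈ Completed k → y ∈ Completed k → ¬ (x isProperSuffixOf y)
      sf (inj₁ x∈X) (inj₁ y∈X) = suffixFree x∈X y∈X
      sf (inj₂ x∈D) (inj₁ y∈X) (s , _) = Added-noFactor y∈X x∈D (fromSuffix s)
      sf (inj₁ x∈X) (inj₂ (added _ _ _ _)) (here e , x≢y) = x≢y (Pointwise-≡⇒≡ e)
      sf (inj₁ x∈X) (inj₂ (added {_} {w} {b} _ w≡k _ wb≡k)) (there s , _) with parses-∷ʳ w b
      ... | inj₁ (_ , eq) = 1+n≢n (trans (sym wb≡k) (trans eq w≡k))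
      ... | inj₂ (¬s , _) = ¬s (_ , x∈X , s)
      sf (inj₂ (added _ _ _ _)) (inj₂ (added _ _ _ _)) (here e , x≢y) = x≢y (Pointwise-≡⇒≡ e)
      -- Dually, `av` would be a suffix of `w` with one parse more.
      sf (inj₂ (added {a} {v} _ _ av≡k _)) (inj₂ (added {_} {w} _ w≡k _ _)) (there s , _) =
        <⇒≱ (≤-reflexive (trans (cong suc w≡k) (sym av≡k)))
          (parses-mono (fromSuffix (Suffix-∷ʳ⁻ (a ∷ v) w s)))

  module _ {k : ℕ} {u : List A} (u∈F : u ∈ F) (k<u : k < parses u) where

    -- The middle `w` of an added word has only `k` parses, so it cannot contain `u` and is shorter
    -- than `n`. With its two outer letters the added word has length at most `suc n`; the summand
    -- `m` takes care of `X`.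
    Completed-bounded : Finite X → ∃[ n ] (∀ {y} → y ∈ Completed k → length y ≤ n)
    Completed-bounded X-finite
      with m , X≤m ← finite⇒bounded length X-finite
      with n , occurs ← recurrence-≤ F-ur u∈F = m + suc n , bound
      where
      bound : ∀ {y} → y ∈ Completed k → length y ≤ m + suc n
      bound (inj₁ x∈X) = ≤-trans (X≤m x∈X) (m≤m+n m _)
      bound (inj₂ (added {a} {w} {b} y∈F w≡k _ _)) with n ≤? length w
      ... | no n≰w  = ≤-trans
          (s≤s (≤-trans (≤-reflexive (trans (length-++ w) (+-comm _ 1))) (≰⇒> n≰w)))
          (m≤n+m _ m)
      ... | yes n≤w = contradiction
        (≤-trans (parses-mono (occurs (factorClosed y∈F (there (here (Prefix-refl ++ᵖ [ b ])))) n≤w))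
                 (≤-reflexive w≡k))
        (<⇒≱ k<u)

    -- Extend `z` until `u` occurs beyond it. If the result has no prefix in `X`, neither does any
    -- `a ∷ w` that begins it, so the left condition on an added word holds automatically and only
    -- the right end `b` has to be found.
    Completed-dense : 1 ≤ k → ∀ {z} → z ∈ F → z ≢ [] →
                      ∃[ s ] ∃[ y ] y ∈ Completed k × Prefix _≡_ y (z ++ s)
    Completed-dense 1≤k {[]}    _   z≢[] = contradiction refl z≢[]
    Completed-dense 1≤k {a ∷ t} z∈F _
      with s , u≤s , zs∈F ← follows F-ur u∈F z∈F
      with em {HasPrefix (a ∷ t ++ s)}
    ... | yes (x , x∈X , p) = s , x , inj₁ x∈X , p
    ... | no ¬p
      -- Reading `t ++ s` starts at `[]` with one parse, whence `1 ≤ k`, and ends above `k` because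
      -- `u` has been read.
      with w , b , r , eq , w≡k , wb≡k ← parses-crossing [] (t ++ s) 1≤k (≤-trans k<u (parses-mono (t ++ⁱ u≤s))) =
      s , a ∷ w ∷ʳ b , inj₂ (added (factorClosed zs∈F (here y≤zs)) w≡k
        (trans (parses-∷-no (λ (x , x∈X , p) → ¬p (x , x∈X , Prefixₚ.trans trans p aw≤zs))) (cong suc w≡k)) wb≡k) , y≤zs
      where
      y≤zs : Prefix _≡_ (a ∷ w ∷ʳ b) (a ∷ t ++ s)
      y≤zs = refl ∷ subst (Prefix _≡_ _) (sym eq) (Prefix-refl ++ᵖ r)
      aw≤zs : Prefix _≡_ (a ∷ w) (a ∷ t ++ s)
      aw≤zs = Prefixₚ.trans trans (Prefix-refl ++ᵖ [ b ]) y≤zs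

mainTheorem10 : {ℓ : Level} → ExcludedMiddle ℓ →
    (A : Set ℓ) → FiniteType A →
    (F : Language A) → UniformlyRecurrent F →
    ((X : Language A) → X ⊆ F → BifixCode X → Thin F X → Finite X)
    ×
    ((X : Language A) → X ⊆ F → BifixCode X → Finite X →
    Σ[ Y ∈ Language A ] (X ⊆ Y × Y ⊆ F × Finite Y × MaximalBifixCode F Y))
mainTheorem10 em A A-finite F F-ur = thin⇒finite , completion
  where
  thin⇒finite : (X : Language A) → X ⊆ F → BifixCode X → Thin F X → Finite X
  thin⇒finite X X⊆F _ (u , u∈F , avoids) with n , occurs ← recurrence-≤ F-ur u∈F =
    bounded⇒finite A-finite em X n λ {x} x∈X →
      ≮⇒≥ λ n<x → avoids x∈X (occurs (X⊆F x∈X) (<⇒≤ n<x))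

  completion : (X : Language A) → X ⊆ F → BifixCode X → Finite X →
    Σ[ Y ∈ Language A ] (X ⊆ Y × Y ⊆ F × Finite Y × MaximalBifixCode F Y)
  completion X X⊆F X-bifix X-finite = complete em
    where
    open Parses em X-bifix
    open Completion em F-ur X⊆F X-bifix

    maxParses : ∃[ m ] (∀ {x} → x ∈ X → parses x ≤ m)
    maxParses = finite⇒bounded parses X-finite

    -- The successor makes the bound on `X` strict and also ensures `1 ≤ k`, as the density argument
    -- requires.
    k : ℕ
    k = suc (proj₁ maxParses)

    X<k : ∀ {x} → x ∈ X → parses x < k
    X<k x∈X = s≤s (proj₂ maxParses x∈X)

    complete : Dec (∃[ u ] u ∈ F × k < parses u) →
      Σ[ Y ∈ Language A ] (X ⊆ Y × Y ⊆ F × Finite Y × MaximalBifixCode F Y)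
    complete (no bounded) = X , (λ x∈X → x∈X) , X⊆F , X-finite ,
      bounded⇒maximal k λ u∈F → ≮⇒≥ λ k<u → bounded (_ , u∈F , k<u)
    complete (yes (u , u∈F , k<u)) with n , bound ← Completed-bounded u∈F k<u X-finite =
      Completed k , inj₁ , Completed⊆F ,
      bounded⇒finite A-finite em (Completed k) n bound ,
      rightDense⇒maximal em (Completed-bifix X<k) (Completed⊆F)
        (Completed-dense u∈F k<u (s≤s z≤n))
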